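{- For every integer $n\geq 1$, $$\tilde{A}_n(x,y|\alpha)=\sum_{\sigma \in \mathrm{PRW}_{n+1}} (u_1u_2)^{\mathrm{M}(\sigma)}\,u_3^{\mathrm{da}(\sigma)}\,u_4^{\mathrm{dd}(\sigma)}\,\alpha^{\mathrm{LRmin}(\sigma)+\mathrm{RLmin}(\sigma)-2},$$ whenever $x+y=u_3+u_4$ and $xy=u_1u_2$.
   Context: $\mathfrak{S}_n$ is the set of permutations $\sigma=\sigma_1\cdots\sigma_n$ of $[n]=\{1,\dots,n\}$. An index $i\in[n-1]$ is a descent (resp. ascent) of $\sigma$ if $\sigma_i>\sigma_{i+1}$ (resp. $\sigma_i<\sigma_{i+1}$); $\mathrm{des}(\sigma)$ and $\mathrm{asc}(\sigma)$ are the numbers of descents and ascents. $\mathrm{PRW}_n$ is the set of $\pi\in\mathfrak{S}_n$ such that the first ascent (if any) of $\pi$ appears at the letter $1$; i.e., if $\pi$ has an ascent and $i$ is the smallest one, then $\pi_i=1$. A left-to-right minimum (resp. right-to-left minimum) of $\sigma\in\mathfrak{S}_n$ is a letter $\sigma_i$ such that $\sigma_j>\sigma_i$ for every $j<i$ (resp. every $j>i$); $\mathrm{LRmin}(\sigma)$ and $\mathrm{RLmin}(\sigma)$ are the numbers of these. With the convention $\sigma_0=\sigma_{n+1}=+\infty$, a value $\sigma_i$ ($1\le i\le n$) is a double ascent if $\sigma_{i-1}<\sigma_i<\sigma_{i+1}$, a double descent if $\sigma_{i-1}>\sigma_i>\sigma_{i+1}$, and a peak if $\sigma_{i-1}<\sigma_i>\sigma_{i+1}$.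 $\mathrm{da}(\sigma)$, $\mathrm{dd}(\sigma)$, $\mathrm{M}(\sigma)$ denote the numbers of double ascents, double descents, and peaks of $\sigma$, respectively. The binomial-Stirling-Eulerian polynomials are $$\tilde{A}_n(x,y|\alpha)=\sum_{\sigma\in\mathrm{PRW}_{n+1}}x^{\mathrm{des}(\sigma)}y^{\mathrm{asc}(\sigma)}\alpha^{\mathrm{LRmin}(\sigma)+\mathrm{RLmin}(\sigma)-2}.$$ -}

module Defs where

open import Level using (Level)
open import Algebra.Bundles using (CommutativeRing)
open import Data.List.Base
  using (List; []; _∷_; _++_; map; foldr; filter; length; upTo; cartesianProductWith)
open import Data.List.Relation.Unary.All using (all?)
open import Data.Maybe.Base using (Maybe; just; nothing)
import Data.Maybe.Relation.Unary.All as Maybe using (All; dec)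
open import Data.Nat.Base as ℕ using (ℕ; zero; suc; _<_; _∸_)
open import Data.Nat.Properties using (_≟_; _<?_)
open import Data.List.Relation.Unary.Unique.DecPropositional _≟_ using (unique?)
open import Data.Bool.Base using (if_then_else_)
open import Data.Product.Base using (_×_; _,_)
open import Relation.Binary.Construct.Add.Supremum.Strict _<_ using (_<⁺_; <⁺-dec)
open import Relation.Binary.Definitions using (Decidable)
open import Relation.Binary.PropositionalEquality.Core using (_≡_)
open import Relation.Nullary.Construct.Add.Supremum using (_⁺; [_]; ⊤⁺)
open import Relation.Nullary.Decidable using (does; _×-dec_)
open import Relation.Unary using (Pred) renaming (Decidable to Decidable₁)

private
  variable
    a p : Level
    A : Set a

-- A permutation σ of {1,…,n} is represented by its word σ₁ ∷ … ∷ σₙ ∷ [].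
Word : Set
Word = List ℕ

letters : ℕ → List ℕ
letters n = map suc (upTo n)

wordsOver : List ℕ → ℕ → List Word
wordsOver L zero    = [] ∷ []
wordsOver L (suc k) = cartesianProductWith _∷_ L (wordsOver L k)

-- The words of length n over {1,…,n} with no repeated letter, each listed once.
𝔖 : ℕ → List Word
𝔖 n = filter unique? (wordsOver (letters n) n)

count : {P : Pred A p} → Decidable₁ P → List A → ℕ
count P? xs = length (filter P? xs)

-- All (wᵢ , wᵢ₊₁).
pairs : List A → List (A × A)
pairs (x ∷ y ∷ w) = (x , y) ∷ pairs (y ∷ w)
pairs _           = []

-- All (wᵢ₋₁ , wᵢ , wᵢ₊₁).
triples : List A → List (A × A × A)
triples (x ∷ y ∷ z ∷ w) = (x , y , z) ∷ triples (y ∷ z ∷ w)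
triples _               = []

-- All (w₁…wᵢ₋₁ , wᵢ , wᵢ₊₁…wₙ).
splits : List A → List (List A × A × List A)
splits []      = []
splits (x ∷ w) = ([] , x , w) ∷ map (λ (u , y , v) → (x ∷ u , y , v)) (splits w)

des asc : Word → ℕ
des σ = count (λ (s , t) → t <? s) (pairs σ)
asc σ = count (λ (s , t) → s <? t) (pairs σ)

-- The letter πᵢ for the smallest ascent i of π, if π has an ascent.
firstAscentLetter : Word → Maybe ℕ
firstAscentLetter (s ∷ t ∷ w) =
  if does (s <? t) then just s else firstAscentLetter (t ∷ w)
firstAscentLetter _           = nothing

IsPRW : Word → Set
IsPRW π = Maybe.All (_≡ 1) (firstAscentLetter π)

isPRW? : Decidable₁ IsPRW
isPRW? π = Maybe.dec (_≟ 1) (firstAscentLetter π)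

PRW : ℕ → List Word
PRW n = filter isPRW? (𝔖 n)

LRmin RLmin : Word → ℕ
LRmin σ = count (λ (u , s , v) → all? (s <?_) u) (splits σ)
RLmin σ = count (λ (u , s , v) → all? (s <?_) v) (splits σ)

_<⁺?_ : Decidable _<⁺_
_<⁺?_ = <⁺-dec _<?_

-- σ₀σ₁…σₙσₙ₊₁ with σ₀ = σₙ₊₁ = +∞.
pad : Word → List (ℕ ⁺)
pad σ = ⊤⁺ ∷ map [_] σ ++ ⊤⁺ ∷ []

da dd M : Word → ℕ
da σ = count (λ (r , s , t) → r <⁺? s ×-dec s <⁺? t) (triples (pad σ))
dd σ = count (λ (r , s , t) → s <⁺? r ×-dec t <⁺? s) (triples (pad σ))
M  σ = count (λ (r , s , t) → r <⁺? s ×-dec t <⁺? s) (triples (pad σ))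

-- Polynomials in x, y, α (and u₁,…,u₄) are given by their values in an
-- arbitrary commutative ring.
module Polynomials {c ℓ} (R : CommutativeRing c ℓ) where
  open CommutativeRing R using (Carrier; _+_; _*_; 0#; semiring)
  open import Algebra.Properties.Semiring.Exp semiring public using (_^_)

  ∑ : List A → (A → Carrier) → Carrier
  ∑ xs f = foldr (λ s acc → f s + acc) 0# xs

  infix 5 ∑
  syntax ∑ xs (λ σ → e) = ∑[ σ ∈ xs ] e

  -- ∸ is a true subtraction here: a nonempty word has LRmin, RLmin ≥ 1.
  Ã : ℕ → Carrier → Carrier → Carrier → Carrier
  Ã n x y α = ∑[ σ ∈ PRW (suc n) ] (x ^ des σ * y ^ asc σ * α ^ (LRmin σ ℕ.+ RLmin σ ∸ 2))

{-# OPTIONS --safe #-}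

-- A PRW word is D 1 W with D decreasing, and every PRW word arises from the word 1 by
-- successively inserting a new largest letter: at the front, at the end, or in an inner
-- slot of 1 W.  Record W by its peaks, of weight w, and by its double ascents and double
-- descents, as factors A and B.  An inner insertion turns an edge of W into an ascent
-- followed by a descent, so it acts as the derivation A, B ↦ w, w ↦ w (A + B); a front
-- insertion multiplies by the constant α b, an end insertion by α A.  Since A and B have
-- the same derivative, A = a + I and B = b + I with a common I vanishing at the start.
-- Hence w' = w (a + b + 2 I), the outer insertions multiply by α (a + b + I), and the
-- iterates depend on a and b through a + b only.  The left-hand side is the case a = y,
-- b = x, w = x y, since asc = M + da and des = M + dd.
module Submission where

open import Defs
open import Algebra.Bundles using (CommutativeRing)
import Algebra.Properties.CommutativeSemiring.Exp as Exp
import Algebra.Solver.Ring.NaturalCoefficients.Default as NaturalCoefficients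
open import Data.Bool.Base using (Bool; true; false; not; _∧_; if_then_else_)
open import Data.List.Base using (List; []; _∷_; _++_; _∷ʳ_; map; concatMap; filter; length; upTo)
open import Data.List.Properties
  using (++-assoc; ++-identityʳ; ++-cancelˡ; ∷-injectiveˡ; ∷-injectiveʳ; map-++; map-∘; map-id;
         map-concatMap; length-map; length-++; length-upTo; upTo-∷ʳ; filter-all; filter-none;
         filter-accept; filter-reject; filter-++)
open import Data.List.Membership.Propositional using (_∈_)
open import Data.List.Membership.Propositional.Properties
  using (∈-∃++; ∈-map⁺; ∈-map⁻; ∈-upTo⁻; ∈-filter⁺; ∈-filter⁻; ∈-concat⁺′;
         ∈-cartesianProductWith⁺; ∈-cartesianProductWith⁻)
open import Data.List.Membership.Propositional.Properties.WithK using (unique∧set⇒bag)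
open import Data.List.Relation.Binary.BagAndSetEquality using (∼bag⇒↭)
open import Data.List.Relation.Binary.Disjoint.Propositional using (Disjoint)
open import Data.List.Relation.Binary.Permutation.Propositional as ↭
  using (_↭_; ↭-sym; ↭-trans; ↭-refl; ↭-prep; ↭-reflexive; ↭⇒↭ₛ)
open import Data.List.Relation.Binary.Permutation.Propositional.Properties
  using (shift; drop-mid; ∈-resp-↭; All-resp-↭; ↭-length; ↭-singleton-inv; ++-comm)
import Data.List.Relation.Binary.Permutation.Setoid.Properties as ↭ₛ
open import Data.List.Relation.Unary.All as All using (All; []; _∷_; all?)
import Data.List.Relation.Unary.All.Properties as All
open import Data.List.Relation.Unary.AllPairs using (AllPairs; []; _∷_)
import Data.List.Relation.Unary.AllPairs.Properties as AllPairs
open import Data.List.Relation.Unary.Any using (here; there)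
open import Data.List.Relation.Unary.Unique.Propositional using (Unique)
import Data.List.Relation.Unary.Unique.Propositional.Properties as Unique
open import Data.Maybe.Relation.Unary.All using (just; nothing)
open import Data.Nat.Base as ℕ using (ℕ; zero; suc; _<_; _>_; _≥_; _∸_; z<s; s<s)
import Data.Nat.Properties as ℕ
open import Data.List.Relation.Unary.Unique.DecPropositional ℕ._≟_ using (unique?)
open import Data.Product.Base using (_×_; _,_; ∃-syntax; proj₁; proj₂)
open import Function.Base using (_∘_)
open import Function.Bundles using (mk⇔)
open import Level using (Level)
open import Relation.Binary.Construct.Add.Supremum.Strict _<_ using (<⁺-cmp-≡)
open import Relation.Binary.Definitions using (tri<; tri≈; tri>)
open import Relation.Binary.PropositionalEquality.Core
  using (_≡_; _≢_; refl; sym; trans; cong; cong₂; subst)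
open import Relation.Binary.PropositionalEquality.Properties as ≡ using (module ≡-Reasoning)
import Relation.Binary.Reasoning.Setoid as ≈-Reasoning
open import Relation.Nullary.Construct.Add.Supremum using (_⁺; [_]; ⊤⁺; []-injective)
open import Relation.Nullary.Decidable
  using (Dec; does; dec-true; dec-false; ¬?; does-⇔; _×-dec_)
open import Relation.Nullary.Negation using (¬_; contradiction)
open import Relation.Unary using (Pred; Decidable)

private
  variable
    ℓ ℓ′ p : Level
    A : Set ℓ
    B : Set ℓ′
    N n : ℕ
    v w : Word

-- Finite sums over lists

module Sums {c ℓ} (R : CommutativeRing c ℓ) where
  open CommutativeRing R hiding (zero) renaming (refl to ≈-refl; sym to ≈-sym; trans to ≈-trans)
  open Polynomials R
  open ≈-Reasoning setoid

  ∑-cong : ∀ (xs : List A) {f g : A → Carrier} → (∀ {x} → x ∈ xs → f x ≈ g x) → ∑ xs f ≈ ∑ xs g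
  ∑-cong []       eq = ≈-refl
  ∑-cong (x ∷ xs) eq = +-cong (eq (here refl)) (∑-cong xs (eq ∘ there))

  ∑-map : (h : A → B) (xs : List A) (f : B → Carrier) → ∑ (map h xs) f ≡ ∑ xs (f ∘ h)
  ∑-map h []       f = refl
  ∑-map h (x ∷ xs) f = cong (f (h x) +_) (∑-map h xs f)

  ∑-++ : (xs ys : List A) (f : A → Carrier) → ∑ (xs ++ ys) f ≈ ∑ xs f + ∑ ys f
  ∑-++ []       ys f = ≈-sym (+-identityˡ _)
  ∑-++ (x ∷ xs) ys f = ≈-trans (+-congˡ (∑-++ xs ys f)) (≈-sym (+-assoc _ _ _))

  ∑-concatMap : (h : A → List B) (xs : List A) (f : B → Carrier) →
    ∑ (concatMap h xs) f ≈ ∑[ x ∈ xs ] ∑ (h x) f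
  ∑-concatMap h []       f = ≈-refl
  ∑-concatMap h (x ∷ xs) f =
    ≈-trans (∑-++ (h x) (concatMap h xs) f) (+-congˡ (∑-concatMap h xs f))

  ∑-distribˡ : ∀ k (xs : List A) (f : A → Carrier) → k * ∑ xs f ≈ ∑[ x ∈ xs ] (k * f x)
  ∑-distribˡ k []       f = zeroʳ k
  ∑-distribˡ k (x ∷ xs) f = ≈-trans (distribˡ _ _ _) (+-congˡ (∑-distribˡ k xs f))

  ∑-↭ : {xs ys : List A} (f : A → Carrier) → xs ↭ ys → ∑ xs f ≈ ∑ ys f
  ∑-↭ f ↭.refl        = ≈-refl
  ∑-↭ f (↭.prep x p)  = +-congˡ (∑-↭ f p)
  ∑-↭ f (↭.swap {xs} {ys} x y p) = begin
    f x + (f y + ∑ xs f) ≈⟨ +-assoc _ _ _ ⟨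
    f x + f y + ∑ xs f   ≈⟨ +-cong (+-comm _ _) (∑-↭ f p) ⟩
    f y + f x + ∑ ys f   ≈⟨ +-assoc _ _ _ ⟩
    f y + (f x + ∑ ys f) ∎
  ∑-↭ f (↭.trans p q) = ≈-trans (∑-↭ f p) (∑-↭ f q)

-- The derivation on products of factors and its iterates

-- In terms of the header, peak is w and lin e is e + I.
data Factor {c} (C : Set c) : Set c where
  peak : Factor C
  lin  : C → Factor C

module _ {c} {C : Set c} where

  -- The terms of the derivative of a product of factors, listed in the order of the
  -- slots whose insertions they count.
  ∂ : C → C → List (Factor C) → List (List (Factor C))
  ∂ a b []           = []
  ∂ a b (peak  ∷ fs) = (peak ∷ lin b ∷ fs) ∷ (lin a ∷ peak ∷ fs) ∷ map (peak ∷_) (∂ a b fs)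
  ∂ a b (lin e ∷ fs) = (peak ∷ fs) ∷ map (lin e ∷_) (∂ a b fs)

module Taylor {c ℓ} (R : CommutativeRing c ℓ) (w s α : CommutativeRing.Carrier R) where
  open CommutativeRing R hiding (zero) renaming (refl to ≈-refl; sym to ≈-sym; trans to ≈-trans)
  open Polynomials R
  open Sums R
  open ≈-Reasoning setoid
  open NaturalCoefficients commutativeSemiring using (solve; _:=_; _:+_; _:*_)

  Factors : Set c
  Factors = List (Factor Carrier)

  val : Factor Carrier → Carrier
  val peak    = w
  val (lin e) = e

  ∏ : Factors → Carrier
  ∏ []       = 1#
  ∏ (f ∷ fs) = val f * ∏ fs

  -- The k-th iterate of φ ↦ φ' + α (s + I) φ, evaluated at I = 0.
  T : Carrier → Carrier → ℕ → Factors → Carrier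
  T a b zero    fs = ∏ fs
  T a b (suc k) fs = ∑ (∂ a b fs) (T a b k) + α * T a b k (fs ∷ʳ lin s)

  -- Reads `e + I = d + (d′ + I)`: the constant `d` comes out as a scalar and the factor disappears,
  -- while the rest keeps its `I`.
  Affine : (Factors → Carrier) → Set _
  Affine φ = ∀ {e} d d′ → e ≈ d + d′ → ∀ fs gs →
    φ (fs ++ lin e ∷ gs) ≈ d * φ (fs ++ gs) + φ (fs ++ lin d′ ∷ gs)

  ∷-affine : ∀ f φ → Affine φ → Affine (φ ∘ (f ∷_))
  ∷-affine f φ aff d d′ e≈ fs gs = aff d d′ e≈ (f ∷ fs) gs

  ∏-affine : Affine ∏
  ∏-affine {e} d d′ e≈ [] gs = ≈-trans (*-congʳ e≈) (distribʳ _ _ _)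
  ∏-affine {e} d d′ e≈ (f ∷ fs) gs = begin
    val f * ∏ (fs ++ lin e ∷ gs) ≈⟨ *-congˡ (∏-affine d d′ e≈ fs gs) ⟩
    val f * (d * ∏ (fs ++ gs) + ∏ (fs ++ lin d′ ∷ gs))
      ≈⟨ solve 4 (λ v d p q → v :* (d :* p :+ q) := d :* (v :* p) :+ v :* q)
               ≈-refl (val f) d _ _ ⟩
    d * (val f * ∏ (fs ++ gs)) + val f * ∏ (fs ++ lin d′ ∷ gs) ∎

  ∑∂-affine-∷ : ∀ a b f {φ} → Affine φ → Affine (λ fs → ∑ (map (f ∷_) (∂ a b fs)) φ)

  -- Every linear factor has derivative `w`, whatever its constant term. The term `peak ∷ gs` is
  -- therefore the same for `e` and for `d′`, and the scalar `d` contributes none.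
  ∑∂-affine : ∀ a b {φ} → Affine φ → Affine (λ fs → ∑ (∂ a b fs) φ)
  ∑∂-affine a b {φ} aff {e} d d′ e≈ [] gs = begin
    φ (peak ∷ gs) + ∑ (map (lin e ∷_) (∂ a b gs)) φ
      ≡⟨ cong (φ (peak ∷ gs) +_) (∑-map _ (∂ a b gs) φ) ⟩
    φ (peak ∷ gs) + ∑ (∂ a b gs) (φ ∘ (lin e ∷_))
      ≈⟨ +-congˡ (∑-affine (∂ a b gs)) ⟩
    φ (peak ∷ gs) + (d * ∑ (∂ a b gs) φ + ∑ (∂ a b gs) (φ ∘ (lin d′ ∷_)))
      ≈⟨ solve 3 (λ p q r → p :+ (q :+ r) := q :+ (p :+ r)) ≈-refl _ _ _ ⟩
    d * ∑ (∂ a b gs) φ + (φ (peak ∷ gs) + ∑ (∂ a b gs) (φ ∘ (lin d′ ∷_)))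
      ≡⟨ cong (λ z → d * ∑ (∂ a b gs) φ + (φ (peak ∷ gs) + z)) (∑-map _ (∂ a b gs) φ) ⟨
    d * ∑ (∂ a b gs) φ + (φ (peak ∷ gs) + ∑ (map (lin d′ ∷_) (∂ a b gs)) φ) ∎
    where
    ∑-affine : ∀ hss → ∑ hss (φ ∘ (lin e ∷_)) ≈ d * ∑ hss φ + ∑ hss (φ ∘ (lin d′ ∷_))
    ∑-affine [] = ≈-sym (≈-trans (+-identityʳ _) (zeroʳ _))
    ∑-affine (hs ∷ hss) = ≈-trans
      (+-cong (aff d d′ e≈ [] hs) (∑-affine hss))
      (solve 5 (λ d p q r t → (d :* p :+ q) :+ (d :* r :+ t) := d :* (p :+ r) :+ (q :+ t))
             ≈-refl d _ _ _ _)
  ∑∂-affine a b {φ} aff {e} d d′ e≈ (peak ∷ fs) gs = ≈-trans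
    (+-cong (aff d d′ e≈ (peak ∷ lin b ∷ fs) gs)
      (+-cong (aff d d′ e≈ (lin a ∷ peak ∷ fs) gs) (∑∂-affine-∷ a b peak aff d d′ e≈ fs gs)))
    (solve 7 (λ d p q r t u v → (d :* p :+ q) :+ ((d :* r :+ t) :+ (d :* u :+ v))
                             := d :* (p :+ (r :+ u)) :+ (q :+ (t :+ v)))
           ≈-refl d _ _ _ _ _ _)
  ∑∂-affine a b {φ} aff {e} d d′ e≈ (lin e′ ∷ fs) gs = ≈-trans
    (+-cong (aff d d′ e≈ (peak ∷ fs) gs) (∑∂-affine-∷ a b (lin e′) aff d d′ e≈ fs gs))
    (solve 5 (λ d p q r t → (d :* p :+ q) :+ (d :* r :+ t) := d :* (p :+ r) :+ (q :+ t))
           ≈-refl d _ _ _ _)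

  ∑∂-affine-∷ a b f {φ} aff {e} d d′ e≈ fs gs
    rewrite ∑-map (f ∷_) (∂ a b (fs ++ lin e ∷ gs)) φ
          | ∑-map (f ∷_) (∂ a b (fs ++ gs)) φ
          | ∑-map (f ∷_) (∂ a b (fs ++ lin d′ ∷ gs)) φ
          = ∑∂-affine a b (∷-affine f φ aff) d d′ e≈ fs gs

  T-affine : ∀ a b k → Affine (T a b k)
  T-affine a b zero    = ∏-affine
  T-affine a b (suc k) {e} d d′ e≈ fs gs
    rewrite ++-assoc fs (lin e ∷ gs) (lin s ∷ [])
          | ++-assoc fs gs (lin s ∷ [])
          | ++-assoc fs (lin d′ ∷ gs) (lin s ∷ []) = ≈-trans
    (+-cong (∑∂-affine a b (T-affine a b k) d d′ e≈ fs gs)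
            (*-congˡ (T-affine a b k d d′ e≈ fs (gs ∷ʳ lin s))))
    (solve 6 (λ d v p q r t → (d :* p :+ q) :+ v :* (d :* r :+ t)
                           := d :* (p :+ v :* r) :+ (q :+ v :* t))
           ≈-refl d α _ _ _ _)

  module _ {a b a′ b′} (a+b≈ : a + b ≈ a′ + b′) where

    ∑∂-invariant-∷ : ∀ f {φ} → Affine φ → ∀ fs →
      ∑ (map (f ∷_) (∂ a b fs)) φ ≈ ∑ (map (f ∷_) (∂ a′ b′ fs)) φ

    -- Only the derivative of a peak mentions `a` and `b`. Splitting both constants off by
    -- affineness leaves `a + b` times a single value of `φ`.
    ∑∂-invariant : ∀ {φ} → Affine φ → ∀ fs → ∑ (∂ a b fs) φ ≈ ∑ (∂ a′ b′ fs) φ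
    ∑∂-invariant aff []           = ≈-refl
    ∑∂-invariant {φ} aff (peak ∷ fs) = begin
      φ (peak ∷ lin b ∷ fs) + (φ (lin a ∷ peak ∷ fs) + ∑ (map (peak ∷_) (∂ a b fs)) φ)
        ≈⟨ heads a b _ ⟩
      (a + b) * φ (peak ∷ fs) + (slopes + ∑ (map (peak ∷_) (∂ a b fs)) φ)
        ≈⟨ +-cong (*-congʳ a+b≈) (+-congˡ (∑∂-invariant-∷ peak aff fs)) ⟩
      (a′ + b′) * φ (peak ∷ fs) + (slopes + ∑ (map (peak ∷_) (∂ a′ b′ fs)) φ)
        ≈⟨ heads a′ b′ _ ⟨
      φ (peak ∷ lin b′ ∷ fs) + (φ (lin a′ ∷ peak ∷ fs) + ∑ (map (peak ∷_) (∂ a′ b′ fs)) φ) ∎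
      where
      -- `lin 0#` is the bare `I`, so this remainder is free of `a` and `b`.
      slopes : Carrier
      slopes = φ (peak ∷ lin 0# ∷ fs) + φ (lin 0# ∷ peak ∷ fs)

      heads : ∀ d e z → φ (peak ∷ lin e ∷ fs) + (φ (lin d ∷ peak ∷ fs) + z)
                      ≈ (d + e) * φ (peak ∷ fs) + (slopes + z)
      heads d e z = ≈-trans
        (+-cong (aff e 0# (≈-sym (+-identityʳ e)) (peak ∷ []) fs)
                (+-congʳ (aff d 0# (≈-sym (+-identityʳ d)) [] (peak ∷ fs))))
        (solve 6 (λ d e p q r z → (e :* p :+ q) :+ ((d :* p :+ r) :+ z)
                               := (d :+ e) :* p :+ ((q :+ r) :+ z))
               ≈-refl d e _ _ _ z)
    ∑∂-invariant aff (lin e ∷ fs) = +-congˡ (∑∂-invariant-∷ (lin e) aff fs)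

    ∑∂-invariant-∷ f {φ} aff fs
      rewrite ∑-map (f ∷_) (∂ a b fs) φ | ∑-map (f ∷_) (∂ a′ b′ fs) φ
            = ∑∂-invariant (∷-affine f φ aff) fs

    T-invariant : ∀ k fs → T a b k fs ≈ T a′ b′ k fs
    T-invariant zero    fs = ≈-refl
    T-invariant (suc k) fs = +-cong
      (≈-trans (∑∂-invariant (T-affine a b k) fs)
             (∑-cong (∂ a′ b′ fs) (λ {gs} _ → T-invariant k gs)))
      (*-congˡ (T-invariant k (fs ∷ʳ lin s)))

-- Permutations as rearrangements of the letters

Unique-resp-↭ : {xs ys : List A} → xs ↭ ys → Unique xs → Unique ys
Unique-resp-↭ p = ↭ₛ.Unique-resp-↭ (≡.setoid _) (↭⇒↭ₛ p)

-- Pigeonhole: each `x` uses up one occurrence in `ys`, the later entries of `xs` differ from `x`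
-- and survive its removal, and equal lengths leave nothing over.
⊆∧length⇒↭ : {xs ys : List A} → Unique xs → (∀ {x} → x ∈ xs → x ∈ ys) →
  length ys ≡ length xs → xs ↭ ys
⊆∧length⇒↭ {ys = []} []       xs⊆ys eq = ↭-refl
⊆∧length⇒↭ {xs = x ∷ xs} (x≢ ∷ u) xs⊆ys eq with xs⊆ys (here refl)
... | x∈ys with ys₁ , ys₂ , refl ← ∈-∃++ x∈ys =
  ↭-trans (↭-prep x (⊆∧length⇒↭ u xs⊆ (ℕ.suc-injective (trans (sym (↭-length (shift x ys₁ ys₂))) eq))))
          (↭-sym (shift x ys₁ ys₂))
  where
  xs⊆ : ∀ {y} → y ∈ xs → y ∈ ys₁ ++ ys₂
  xs⊆ y∈ with ∈-resp-↭ (shift x ys₁ ys₂) (xs⊆ys (there y∈))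
  ... | here refl = contradiction refl (All.lookup x≢ y∈)
  ... | there p   = p

letters-suc : ∀ n → letters (suc n) ↭ suc n ∷ letters n
letters-suc n = ↭-trans
  (↭-reflexive (trans (cong (map suc) (sym (upTo-∷ʳ n))) (map-++ suc (upTo n) (n ∷ []))))
  (++-comm (letters n) (suc n ∷ []))

letters-bounds : ∀ n → All (λ x → 0 < x × x < suc n) (letters n)
letters-bounds n = All.tabulate λ x∈ → unpack (∈-map⁻ suc x∈)
  where
  unpack : ∀ {x} → ∃[ y ] (y ∈ upTo n × x ≡ suc y) → 0 < x × x < suc n
  unpack (_ , y∈ , refl) = z<s , s<s (∈-upTo⁻ y∈)

letters-! : ∀ n → Unique (letters n)
letters-! n = Unique.map⁺ ℕ.suc-injective (Unique.upTo⁺ n)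

∈-wordsOver⁺ : ∀ {L} w → All (_∈ L) w → w ∈ wordsOver L (length w)
∈-wordsOver⁺ []      []         = here refl
∈-wordsOver⁺ (x ∷ w) (x∈ ∷ w∈) = ∈-cartesianProductWith⁺ _∷_ x∈ (∈-wordsOver⁺ w w∈)

∈-wordsOver⁻ : ∀ L k → w ∈ wordsOver L k → length w ≡ k × All (_∈ L) w
∈-wordsOver⁻ L zero    (here refl) = refl , []
∈-wordsOver⁻ L (suc k) w∈
  with _ , _ , x∈ , v∈ , refl ← ∈-cartesianProductWith⁻ _∷_ L (wordsOver L k) w∈
  with refl , v⊆ ← ∈-wordsOver⁻ L k v∈ = refl , x∈ ∷ v⊆

wordsOver-! : ∀ {L} k → Unique L → Unique (wordsOver L k)
wordsOver-! zero    u = [] ∷ []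
wordsOver-! (suc k) u =
  Unique.cartesianProductWith⁺ _∷_ (λ eq → ∷-injectiveˡ eq , ∷-injectiveʳ eq) u (wordsOver-! k u)

length-letters : ∀ n → length (letters n) ≡ n
length-letters n = trans (length-map suc (upTo n)) (length-upTo n)

∈-𝔖⁺ : w ↭ letters n → w ∈ 𝔖 n
∈-𝔖⁺ {w} {n} p = ∈-filter⁺ unique?
  (subst (λ k → w ∈ wordsOver (letters n) k) (trans (↭-length p) (length-letters n))
    (∈-wordsOver⁺ w (All.tabulate (∈-resp-↭ p))))
  (Unique-resp-↭ (↭-sym p) (letters-! n))

∈-𝔖⁻ : w ∈ 𝔖 n → w ↭ letters n
∈-𝔖⁻ {w} {n} w∈ with w∈words , u ← ∈-filter⁻ unique? {xs = wordsOver (letters n) n} w∈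
  with length≡ , w⊆ ← ∈-wordsOver⁻ (letters n) n w∈words =
  ⊆∧length⇒↭ u (All.lookup w⊆) (trans (length-letters n) (sym length≡))

PRW-! : ∀ n → Unique (PRW n)
PRW-! n = Unique.filter⁺ isPRW? (Unique.filter⁺ unique? (wordsOver-! n (letters-! n)))

-- Generating PRW words by inserting the largest letter

-- A PRW word D 1 W, with D decreasing, is stored as (D , W).
word : Word × Word → Word
word (D , W) = D ++ 1 ∷ W

-- The slot between 1 and `W` is included. The slot at the end is left out, since filling it changes
-- `RLmin`.
insertInner : ℕ → Word → List Word
insertInner N []      = []
insertInner N (x ∷ w) = (N ∷ x ∷ w) ∷ map (x ∷_) (insertInner N w)

-- For a new largest letter no other slot is admissible: directly behind a letter of `D` it would
-- create an ascent at a letter other than 1.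
grow : ℕ → Word × Word → List (Word × Word)
grow N (D , W) = (N ∷ D , W) ∷ (D , W ∷ʳ N) ∷ map (D ,_) (insertInner N W)

generated : ℕ → List (Word × Word)
generated zero    = ([] , []) ∷ []
generated (suc n) = concatMap (grow (2 ℕ.+ n)) (generated n)

insertInner-split : ∀ w → v ∈ insertInner N w → ∃[ u ] ∃[ u′ ] (v ≡ u ++ N ∷ u′ × u ++ u′ ≡ w)
insertInner-split (x ∷ w) (here refl) = [] , x ∷ w , refl , refl
insertInner-split (x ∷ w) (there v∈)
  with _ , v∈ , refl ← ∈-map⁻ (x ∷_) v∈
  with u , u′ , refl , refl ← insertInner-split w v∈ = x ∷ u , u′ , refl , refl

∈-insertInner : ∀ u {x} → u ++ N ∷ x ∷ w ∈ insertInner N (u ++ x ∷ w)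
∈-insertInner []      = here refl
∈-insertInner (y ∷ u) = there (∈-map⁺ (y ∷_) (∈-insertInner u))

record Valid (n : ℕ) (p : Word × Word) : Set where
  constructor valid
  field
    perm       : word p ↭ letters (suc n)
    decreasing : AllPairs _>_ (proj₁ p ∷ʳ 1)
    1<         : All (1 <_) (proj₂ p)

  bounds : All (λ x → 0 < x × x < 2 ℕ.+ n) (word p)
  bounds = All-resp-↭ (↭-sym perm) (letters-bounds (suc n))

  <top : All (_< 2 ℕ.+ n) (word p)
  <top = All.map proj₂ bounds

  distinct : Unique (word p)
  distinct = Unique-resp-↭ (↭-sym perm) (letters-! (suc n))

open Valid

grow-split : ∀ p {q} → q ∈ grow N p → ∃[ u ] ∃[ v ] (word q ≡ u ++ N ∷ v × u ++ v ≡ word p)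
grow-split (D , W) (here refl)         = [] , _ , refl , refl
grow-split (D , W) (there (here refl)) =
  D ++ 1 ∷ W , [] , sym (++-assoc D (1 ∷ W) _) , ++-identityʳ _
grow-split {N} (D , W) (there (there q∈))
  with _ , v∈ , refl ← ∈-map⁻ (D ,_) q∈
  with u , v , refl , refl ← insertInner-split W v∈ =
  D ++ 1 ∷ u , v , sym (++-assoc D (1 ∷ u) (N ∷ v)) , ++-assoc D (1 ∷ u) v

grow-↭ : ∀ p {q} → q ∈ grow N p → word q ↭ N ∷ word p
grow-↭ p q∈ with u , v , eq , eq′ ← grow-split p q∈ =
  ↭-trans (↭-reflexive eq) (↭-trans (shift _ u v) (↭-reflexive (cong (_ ∷_) eq′)))

insertInner-↭ : ∀ w → v ∈ insertInner N w → v ↭ N ∷ w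
insertInner-↭ w v∈ with u , u′ , refl , refl ← insertInner-split w v∈ = shift _ u u′

grow-valid : ∀ {p q} → Valid n p → q ∈ grow (2 ℕ.+ n) p → Valid (suc n) q
grow-valid {n} {D , W} P q∈ = valid
  (↭-trans (grow-↭ (D , W) q∈) (↭-trans (↭-prep _ (perm P)) (↭-sym (letters-suc (suc n)))))
  (decr q∈) (1<q q∈)
  where
  decr : ∀ {q} → q ∈ grow (2 ℕ.+ n) (D , W) → AllPairs _>_ (proj₁ q ∷ʳ 1)
  decr (here refl)         = All.∷ʳ⁺ (All.++⁻ˡ D (<top P)) (s<s z<s) ∷ decreasing P
  decr (there (here refl)) = decreasing P
  decr (there (there q∈)) with _ , _ , refl ← ∈-map⁻ (D ,_) q∈ = decreasing P

  1<q : ∀ {q} → q ∈ grow (2 ℕ.+ n) (D , W) → All (1 <_) (proj₂ q)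
  1<q (here refl)         = 1< P
  1<q (there (here refl)) = All.∷ʳ⁺ (1< P) (s<s z<s)
  1<q (there (there q∈)) with _ , v∈ , refl ← ∈-map⁻ (D ,_) q∈ =
    All-resp-↭ (↭-sym (insertInner-↭ W v∈)) (s<s z<s ∷ 1< P)

generated-valid : ∀ n → All (Valid n) (generated n)
generated-valid zero    = valid ↭-refl ([] ∷ []) [] ∷ []
generated-valid (suc n) = All.concat⁺ (All.map⁺
  (All.map (λ P → All.tabulate (grow-valid P)) (generated-valid n)))

-- All steps inside `D` and from `D` to 1 descend, and a first letter of `W` makes an ascent at 1.
IsPRW-word : ∀ D W → AllPairs _>_ (D ∷ʳ 1) → All (1 <_) W → IsPRW (word (D , W))
IsPRW-word []       []      _ _ = nothing
IsPRW-word []       (x ∷ W) _ (1<x ∷ _) rewrite dec-true (1 ℕ.<? x) 1<x = just refl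
IsPRW-word (d ∷ []) W ((1<d ∷ _) ∷ ds) 1<W rewrite dec-false (d ℕ.<? 1) (ℕ.<-asym 1<d) =
  IsPRW-word [] W ds 1<W
IsPRW-word (d ∷ e ∷ D) W ((e<d ∷ _) ∷ ds) 1<W rewrite dec-false (d ℕ.<? e) (ℕ.<-asym e<d) =
  IsPRW-word (e ∷ D) W ds 1<W

word∈PRW : ∀ {p} → Valid n p → word p ∈ PRW (suc n)
word∈PRW P = ∈-filter⁺ isPRW? (∈-𝔖⁺ (perm P)) (IsPRW-word _ _ (decreasing P) (1< P))

-- The letter in front of N begins an ascent.
1∈prefix : ∀ {a} u → All (_< N) (a ∷ u) → IsPRW (a ∷ u ++ N ∷ v) → 1 ∈ a ∷ u
1∈prefix {N = N} {a = a} [] (a<N ∷ _) prw rewrite dec-true (a ℕ.<? N) a<N with just refl ← prw = here refl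
1∈prefix {a = a} (b ∷ u) (_ ∷ u<N) prw with does (a ℕ.<? b) | prw
... | true  | just refl = here refl
... | false | prw′      = there (1∈prefix u u<N prw′)

-- An earlier first ascent is untouched, and a leading `N` only begins a descent. If the first
-- ascent is the one into `N`, it is at 1, and the letter that moves up behind 1 exceeds it.
IsPRW-delete : ∀ u → All (_< N) (u ++ v) → All (0 <_) (u ++ v) → Unique (u ++ v) →
  IsPRW (u ++ N ∷ v) → IsPRW (u ++ v)
IsPRW-delete {v = []}    [] _ _ _ _ = nothing
IsPRW-delete {N = N} {v = b ∷ v} [] (b<N ∷ _) _ _ prw
  rewrite dec-false (N ℕ.<? b) (ℕ.<-asym b<N) = prw
IsPRW-delete {v = []}    (a ∷ []) _ _ _ _ = nothing
IsPRW-delete {N = N} {v = b ∷ v} (a ∷ []) (a<N ∷ _) (_ ∷ 0<b ∷ _) ((a≢b ∷ _) ∷ _) prw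
  rewrite dec-true (a ℕ.<? N) a<N with just refl ← prw
  rewrite dec-true (1 ℕ.<? b) (ℕ.≤∧≢⇒< 0<b a≢b) = just refl
IsPRW-delete (a ∷ b ∷ u) (_ ∷ <N) (_ ∷ 0<) (_ ∷ uniq) prw with does (a ℕ.<? b) | prw
... | true  | prw′ = prw′
... | false | prw′ = IsPRW-delete (b ∷ u) <N 0< uniq prw′

-- No letter of `D` is 1, so a prefix that contains 1 runs through all of `D`.
split-after-1 : ∀ {W} D u → All (1 <_) D → 1 ∈ u → word (D , W) ≡ u ++ v →
  ∃[ W₁ ] (u ≡ D ++ 1 ∷ W₁ × W ≡ W₁ ++ v)
split-after-1 []      (a ∷ u) _ _ refl = u , refl , refl
split-after-1 (d ∷ D) (a ∷ u) (1<d ∷ 1<D) 1∈ eq with refl ← ∷-injectiveˡ eq | 1∈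
... | here refl = contradiction 1<d (ℕ.<-irrefl refl)
... | there 1∈u with W₁ , refl , refl ← split-after-1 D u 1<D 1∈u (∷-injectiveʳ eq) = W₁ , refl , refl

>last : ∀ D → AllPairs _>_ (D ∷ʳ 1) → All (1 <_) D
>last []      _          = []
>last (d ∷ D) (d> ∷ ds) = proj₂ (All.∷ʳ⁻ d>) ∷ >last D ds

-- Any slot to the right of 1 is covered: it is the end slot if `v` is empty and an inner slot
-- otherwise.
grow-complete-after-1 : ∀ u {p} → Valid n p → 1 ∈ u → word p ≡ u ++ v →
  ∃[ q ] (q ∈ grow N p × word q ≡ u ++ N ∷ v)
grow-complete-after-1 {v = v} {N = N} u {D , W} P 1∈u eq
  with W₁ , refl , refl ← split-after-1 D u (>last D (decreasing P)) 1∈u eq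
  with v
... | []    = (D , (W₁ ++ []) ∷ʳ N) , there (here refl) ,
  trans (cong (λ z → D ++ 1 ∷ z ∷ʳ N) (++-identityʳ W₁)) (sym (++-assoc D (1 ∷ W₁) _))
... | x ∷ v = (D , W₁ ++ N ∷ x ∷ v) , there (there (∈-map⁺ (D ,_) (∈-insertInner W₁))) ,
  sym (++-assoc D (1 ∷ W₁) _)

-- Away from the front, the largest letter ends an ascent, so the PRW condition forces 1 to stand
-- before it.
grow-complete : ∀ u {p} → Valid n p → word p ≡ u ++ v → IsPRW (u ++ 2 ℕ.+ n ∷ v) →
  ∃[ q ] (q ∈ grow (2 ℕ.+ n) p × word q ≡ u ++ 2 ℕ.+ n ∷ v)
grow-complete []      P refl _ = _ , here refl , refl
grow-complete (a ∷ u) P eq prw = grow-complete-after-1 (a ∷ u) P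
  (1∈prefix u (All.++⁻ˡ (a ∷ u) (subst (All _) eq (<top P))) prw) eq

-- Induction: removing the largest letter leaves a smaller PRW word, which is generated, and
-- `grow-complete` puts the letter back.
generated-complete : ∀ n w → w ↭ letters (suc n) → IsPRW w → ∃[ p ] (p ∈ generated n × word p ≡ w)
generated-complete zero    w p prw with refl ← ↭-singleton-inv p = _ , here refl , refl
generated-complete (suc n) w p prw
  with u , v , refl ← ∈-∃++ (∈-resp-↭ (↭-sym (↭-trans p (letters-suc (suc n)))) (here refl))
  with p′ ← drop-mid u [] (↭-trans p (letters-suc (suc n)))
  with bounded ← All-resp-↭ (↭-sym p′) (letters-bounds (suc n))
  with q , q∈ , eq ← generated-complete n (u ++ v) p′
         (IsPRW-delete u (All.map proj₂ bounded) (All.map proj₁ bounded)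
           (Unique-resp-↭ (↭-sym p′) (letters-! (suc n))) prw)
  with r , r∈ , eq′ ← grow-complete u (All.lookup (generated-valid n) q∈) eq prw =
  r , ∈-concat⁺′ r∈ (∈-map⁺ (grow (2 ℕ.+ n)) q∈) , eq′

-- Each PRW word is generated once

_≢?_ : (k x : ℕ) → Dec (k ≢ x)
k ≢? x = ¬? (k ℕ.≟ x)

delete : ℕ → Word → Word
delete k = filter (k ≢?_)

delete-insert : ∀ u → All (N ≢_) (u ++ v) → delete N (u ++ N ∷ v) ≡ u ++ v
delete-insert {N} {v} [] N≢v =
  trans (filter-reject (N ≢?_) {x = N} {xs = v} (contradiction refl)) (filter-all (N ≢?_) N≢v)
delete-insert {N} {v} (a ∷ u) (N≢a ∷ N≢) =
  trans (filter-accept (N ≢?_) {xs = u ++ N ∷ v} N≢a) (cong (a ∷_) (delete-insert u N≢))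

-- Recovers the parent of a generated word, so that different parents have disjoint offspring.
delete-grow : ∀ {p q} → All (_< N) (word p) → q ∈ grow N p → delete N (word q) ≡ word p
delete-grow {p = p} <N q∈ with u , v , eq , eq′ ← grow-split p q∈ =
  trans (cong (delete _) eq) (trans (delete-insert u (subst (All _) (sym eq′) (All.map ℕ.>⇒≢ <N))) eq′)

∷ʳ∉insertInner : ∀ w → All (_< N) w → All (w ∷ʳ N ≢_) (insertInner N w)
∷ʳ∉insertInner []      _           = []
∷ʳ∉insertInner (x ∷ w) (x<N ∷ w<N) =
  (λ eq → ℕ.<⇒≢ x<N (∷-injectiveˡ eq)) ∷
  All.map⁺ (All.map (_∘ ∷-injectiveʳ) (∷ʳ∉insertInner w w<N))

insertInner-! : ∀ w → All (_< N) w → Unique (insertInner N w)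
insertInner-! []      _           = []
insertInner-! (x ∷ w) (x<N ∷ w<N) =
  All.map⁺ (All.tabulate λ _ eq → ℕ.>⇒≢ x<N (∷-injectiveˡ eq)) ∷
  Unique.map⁺ ∷-injectiveʳ (insertInner-! w w<N)

-- Only the front insertion begins with `N`; the others share the prefix `D` 1 and are told apart by
-- the position of `N` behind it.
grow-! : ∀ {p} → All (_< N) (word p) → Unique (map word (grow N p))
grow-! {N} {D , W} <N =
  All.map⁺ (All.map⁺ {xs = W ∷ʳ N ∷ insertInner N W} (All.tabulate λ _ → front≢ D <N)) ∷
  subst Unique (map-∘ (W ∷ʳ N ∷ insertInner N W))
    (Unique.map⁺ (λ eq → ∷-injectiveʳ (++-cancelˡ D _ _ eq))
      (∷ʳ∉insertInner W W<N ∷ insertInner-! W W<N))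
  where
  W<N : All (_< N) W
  W<N = All.tail (All.++⁻ʳ D <N)

  front≢ : ∀ D {u v w} → All (_< N) (D ++ 1 ∷ w) → N ∷ u ≢ D ++ 1 ∷ v
  front≢ []      (1<N ∷ _) eq = ℕ.>⇒≢ 1<N (∷-injectiveˡ eq)
  front≢ (d ∷ D) (d<N ∷ _) eq = ℕ.>⇒≢ d<N (∷-injectiveˡ eq)

generated-! : ∀ n → Unique (map word (generated n))
generated-! zero    = [] ∷ []
generated-! (suc n) = subst Unique (sym (map-concatMap word (grow (2 ℕ.+ n)) (generated n)))
  (Unique.concat⁺ (All.map⁺ (All.map (grow-! ∘ <top) (generated-valid n)))
    (AllPairs.map⁺ (disjoint (generated-valid n) (AllPairs.map⁻ (generated-! n)))))
  where
  grow-disjoint : ∀ {p q} → Valid n p → Valid n q → word p ≢ word q →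
    Disjoint (map word (grow (2 ℕ.+ n) p)) (map word (grow (2 ℕ.+ n) q))
  grow-disjoint P Q p≢q (w∈ , w∈′)
    with _ , r∈ , refl ← ∈-map⁻ word w∈ | _ , r∈′ , eq ← ∈-map⁻ word w∈′ =
    p≢q (trans (sym (delete-grow (<top P) r∈)) (trans (cong (delete (2 ℕ.+ n)) eq) (delete-grow (<top Q) r∈′)))

  disjoint : ∀ {ps} → All (Valid n) ps → AllPairs (λ p q → word p ≢ word q) ps →
    AllPairs (λ p q → Disjoint (map word (grow (2 ℕ.+ n) p)) (map word (grow (2 ℕ.+ n) q))) ps
  disjoint []       []       = []
  disjoint (P ∷ Ps) (≢ ∷ ≢s) =
    All.zipWith (λ (Q , p≢q) {_} → grow-disjoint P Q p≢q) (Ps , ≢) ∷ disjoint Ps ≢s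

PRW-↭ : ∀ n → PRW (suc n) ↭ map word (generated n)
PRW-↭ n = ∼bag⇒↭ (unique∧set⇒bag (PRW-! (suc n)) (generated-! n) (mk⇔ to from))
  where
  to : ∀ {w} → w ∈ PRW (suc n) → w ∈ map word (generated n)
  to w∈ with w∈𝔖 , prw ← ∈-filter⁻ isPRW? {xs = 𝔖 (suc n)} w∈
    with _ , p∈ , refl ← generated-complete n _ (∈-𝔖⁻ w∈𝔖) prw = ∈-map⁺ word p∈

  from : ∀ {w} → w ∈ map word (generated n) → w ∈ PRW (suc n)
  from w∈ with _ , p∈ , refl ← ∈-map⁻ word w∈ = word∈PRW (All.lookup (generated-valid n) p∈)

-- Left-to-right and right-to-left minima under insertion

bump : Bool → ℕ → ℕ
bump b k = if b then suc k else k

count-∷ : {P : Pred A p} (P? : Decidable P) (x : A) (xs : List A) →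
  count P? (x ∷ xs) ≡ bump (does (P? x)) (count P? xs)
count-∷ P? x xs with does (P? x)
... | true  = refl
... | false = refl

count-map : {P : Pred B p} (P? : Decidable P) (f : A → B) (xs : List A) →
  count P? (map f xs) ≡ count (P? ∘ f) xs
count-map P? f []       = refl
count-map P? f (x ∷ xs) with does (P? (f x))
... | true  = cong suc (count-map P? f xs)
... | false = count-map P? f xs

isRLmin? : Decidable {A = Word × ℕ × Word} (λ (u , s , v) → All (s <_) v)
isRLmin? (u , s , v) = all? (s ℕ.<?_) v

RLmin-∷ : ∀ x w → RLmin (x ∷ w) ≡ bump (does (all? (x ℕ.<?_) w)) (RLmin w)
RLmin-∷ x w = trans (count-∷ isRLmin? ([] , x , w) (map (λ (u , y , v) → (x ∷ u , y , v)) (splits w)))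
  (cong (bump _) (count-map isRLmin? (λ (u , y , v) → (x ∷ u , y , v)) (splits w)))

-- `N` has a smaller letter to its right, and being the largest it spoils no other minimum.
RLmin-insertInner : ∀ w → All (_< N) w → v ∈ insertInner N w → RLmin v ≡ RLmin w
RLmin-insertInner {N} (x ∷ w) (x<N ∷ _) (here refl) =
  trans (RLmin-∷ N (x ∷ w))
    (cong (λ b → bump b (RLmin (x ∷ w)))
      (dec-false (all? (N ℕ.<?_) (x ∷ w)) λ N< → ℕ.<-asym x<N (All.head N<)))
RLmin-insertInner {N} (x ∷ w) (x<N ∷ w<N) (there v∈)
  with v , v∈ , refl ← ∈-map⁻ (x ∷_) v∈ =
  trans (RLmin-∷ x v) (trans (cong₂ bump
    (does-⇔ (mk⇔ (All.tail ∘ All-resp-↭ (insertInner-↭ w v∈))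
                 (λ x<w → All-resp-↭ (↭-sym (insertInner-↭ w v∈)) (x<N ∷ x<w)))
            (all? (x ℕ.<?_) v) (all? (x ℕ.<?_) w))
    (RLmin-insertInner w w<N v∈)) (sym (RLmin-∷ x w)))

RLmin-∷ʳ : ∀ w → All (_< N) w → RLmin (w ∷ʳ N) ≡ suc (RLmin w)
RLmin-∷ʳ []      _ = refl
RLmin-∷ʳ {N} (x ∷ w) (x<N ∷ w<N) = trans (RLmin-∷ x (w ∷ʳ N)) (trans (cong₂ bump
    (does-⇔ (mk⇔ (All.++⁻ˡ w) (λ x<w → All.∷ʳ⁺ x<w x<N))
            (all? (x ℕ.<?_) (w ∷ʳ N)) (all? (x ℕ.<?_) w))
    (RLmin-∷ʳ w w<N)) (trans (bump-suc (does (all? (x ℕ.<?_) w))) (cong suc (sym (RLmin-∷ x w)))))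
  where
  bump-suc : ∀ b {k} → bump b (suc k) ≡ suc (bump b k)
  bump-suc true  = refl
  bump-suc false = refl

-- The later 1 rules out every letter of `D`; the added one is the letter 1 itself.
RLmin-word : ∀ D W → All (1 <_) D → All (1 <_) W → RLmin (word (D , W)) ≡ suc (RLmin W)
RLmin-word []      W _           1<W = trans (RLmin-∷ 1 W)
  (cong (λ b → bump b (RLmin W)) (dec-true (all? (1 ℕ.<?_) W) 1<W))
RLmin-word (d ∷ D) W (1<d ∷ 1<D) 1<W = trans (RLmin-∷ d (word (D , W)))
  (trans (cong (λ b → bump b (RLmin (word (D , W))))
      (dec-false (all? (d ℕ.<?_) (word (D , W)))
                 (λ d< → ℕ.<-asym 1<d (All.head (All.++⁻ʳ D d<)))))
    (RLmin-word D W 1<D 1<W))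

splits-++ : (xs ys : List A) → splits (xs ++ ys) ≡
  map (λ (u , y , v) → (u , y , v ++ ys)) (splits xs) ++ map (λ (u , y , v) → (xs ++ u , y , v)) (splits ys)
splits-++ []       ys = sym (map-id (splits ys))
splits-++ (x ∷ xs) ys = cong (([] , x , xs ++ ys) ∷_)
  (trans (cong (map _) (splits-++ xs ys))
    (trans (map-++ _ (map _ (splits xs)) _)
      (cong₂ _++_ (trans (sym (map-∘ (splits xs))) (map-∘ (splits xs))) (sym (map-∘ (splits ys))))))

splits-middle : ∀ {P : Pred A p} {xs} → All P xs → All (λ (_ , y , _) → P y) (splits xs)
splits-middle []         = []
splits-middle (px ∷ pxs) = px ∷ All.map⁺ (splits-middle pxs)

length-splits : (xs : List A) → length (splits xs) ≡ length xs
length-splits []       = refl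
length-splits (x ∷ xs) = cong suc (trans (length-map _ (splits xs)) (length-splits xs))

decreasing-LRmin : ∀ {w} → AllPairs _>_ w → All (λ (u , s , _) → All (s <_) u) (splits w)
decreasing-LRmin []         = []
decreasing-LRmin (x> ∷ xs>) =
  [] ∷ All.map⁺ (All.zipWith (λ (s<x , s<u) → s<x ∷ s<u) (splits-middle x> , decreasing-LRmin xs>))

isLRmin? : Decidable {A = Word × ℕ × Word} (λ (u , s , v) → All (s <_) u)
isLRmin? (u , s , v) = all? (s ℕ.<?_) u

-- All letters of the decreasing prefix `D` 1 are minima, and none behind 1 can be.
LRmin-word : ∀ D W → AllPairs _>_ (D ∷ʳ 1) → All (1 <_) W → LRmin (word (D , W)) ≡ suc (length D)
LRmin-word D W D> 1<W = begin
  LRmin (D ++ 1 ∷ W)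
    ≡⟨ cong LRmin (++-assoc D (1 ∷ []) W) ⟨
  LRmin ((D ∷ʳ 1) ++ W)
    ≡⟨ cong (count isLRmin?) (splits-++ (D ∷ʳ 1) W) ⟩
  count isLRmin? (early ++ late)
    ≡⟨ cong length (filter-++ isLRmin? early late) ⟩
  length (filter isLRmin? early ++ filter isLRmin? late)
    ≡⟨ cong length (cong₂ _++_ (filter-all isLRmin? (All.map⁺ (decreasing-LRmin D>)))
         (filter-none isLRmin? (All.map⁺ (All.map (λ {(u , _)} → notMin u) (splits-middle 1<W))))) ⟩
  length (early ++ [])
    ≡⟨ cong length (++-identityʳ early) ⟩
  length early
    ≡⟨ length-map _ (splits (D ∷ʳ 1)) ⟩
  length (splits (D ∷ʳ 1))
    ≡⟨ length-splits (D ∷ʳ 1) ⟩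
  length (D ∷ʳ 1)
    ≡⟨ length-++ D ⟩
  length D ℕ.+ 1
    ≡⟨ ℕ.+-comm (length D) 1 ⟩
  suc (length D) ∎
  where
  open ≡-Reasoning

  early late : List (Word × ℕ × Word)
  early = map (λ (u , y , v) → (u , y , v ++ W)) (splits (D ∷ʳ 1))
  late  = map (λ (u , y , v) → ((D ∷ʳ 1) ++ u , y , v)) (splits W)

  notMin : ∀ u {s} → 1 < s → ¬ All (s <_) ((D ∷ʳ 1) ++ u)
  notMin u 1<s s< = ℕ.<-asym 1<s (proj₂ (All.∷ʳ⁻ (All.++⁻ˡ (D ∷ʳ 1) s<)))

-- Peaks, double ascents and double descents

Triple : Set
Triple = (ℕ ⁺) × (ℕ ⁺) × (ℕ ⁺)

-- `M`, `da` and `dd` on arbitrary lists of triples, which allows recursion along a suffix whose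
-- left neighbour is no longer `⊤⁺`.
peaks rises falls : List Triple → ℕ
peaks = count (λ (r , s , t) → r <⁺? s ×-dec t <⁺? s)
rises = count (λ (r , s , t) → r <⁺? s ×-dec s <⁺? t)
falls = count (λ (r , s , t) → s <⁺? r ×-dec t <⁺? s)

window : ℕ ⁺ → ℕ → Word → List Triple
window r x w = triples (r ∷ [ x ] ∷ map [_] w ++ ⊤⁺ ∷ [])

up : ℕ ⁺ → ℕ ⁺ → Bool
up r s = does (r <⁺? s)

-- Lets one Boolean per edge determine all three statistics.
up-flip : ∀ r s → r ≢ s → up s r ≡ not (up r s)
up-flip r s r≢s with <⁺-cmp-≡ ℕ.<-cmp r s
... | tri< r<s _   s≮r rewrite dec-true (r <⁺? s) r<s = dec-false (s <⁺? r) s≮r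
... | tri≈ _   r≡s _   = contradiction r≡s r≢s
... | tri> r≮s _   s<r rewrite dec-false (r <⁺? s) r≮s = dec-true (s <⁺? r) s<r

module _ (r s t : ℕ ⁺) (T : List Triple) where

  peaks-∷ : s ≢ t → peaks ((r , s , t) ∷ T) ≡ bump (up r s ∧ not (up s t)) (peaks T)
  peaks-∷ s≢t = trans (count-∷ _ (r , s , t) T)
    (cong (λ b → bump (up r s ∧ b) (peaks T)) (up-flip s t s≢t))

  rises-∷ : rises ((r , s , t) ∷ T) ≡ bump (up r s ∧ up s t) (rises T)
  rises-∷ = count-∷ _ (r , s , t) T

  falls-∷ : r ≢ s → s ≢ t → falls ((r , s , t) ∷ T) ≡ bump (not (up r s) ∧ not (up s t)) (falls T)
  falls-∷ r≢s s≢t = trans (count-∷ _ (r , s , t) T)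
    (cong₂ (λ b c → bump (b ∧ c) (falls T)) (up-flip r s r≢s) (up-flip s t s≢t))

asc-∷ : ∀ x y w → asc (x ∷ y ∷ w) ≡ bump (up [ x ] [ y ]) (asc (y ∷ w))
asc-∷ x y w = count-∷ _ (x , y) (pairs (y ∷ w))

des-∷ : ∀ {x y} w → [ x ] ≢ [ y ] → des (x ∷ y ∷ w) ≡ bump (not (up [ x ] [ y ])) (des (y ∷ w))
des-∷ {x} {y} w x≢y = trans (count-∷ _ (x , y) (pairs (y ∷ w)))
  (cong (λ b → bump b (des (y ∷ w))) (up-flip [ x ] [ y ] x≢y))

-- A letter entered by an ascent is a peak or a double ascent. The `bump` accounts for the edge from
-- `r` into `x`.
peaks+rises≡asc : ∀ r x w → Unique (x ∷ w) →
  peaks (window r x w) ℕ.+ rises (window r x w) ≡ bump (up r [ x ]) (asc (x ∷ w))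
peaks+rises≡asc r x [] _
  rewrite peaks-∷ r [ x ] ⊤⁺ [] (λ ()) | rises-∷ r [ x ] ⊤⁺ [] with up r [ x ]
... | true  = refl
... | false = refl
peaks+rises≡asc r x (y ∷ w) ((x≢y ∷ _) ∷ u)
  rewrite peaks-∷ r [ x ] [ y ] (window [ x ] y w) (x≢y ∘ []-injective)
        | rises-∷ r [ x ] [ y ] (window [ x ] y w)
        | asc-∷ x y w
        = step (up r [ x ]) (up [ x ] [ y ]) (peaks+rises≡asc [ x ] y w u)
  where
  step : ∀ b c {i j k} → i ℕ.+ j ≡ bump c k →
    bump (b ∧ not c) i ℕ.+ bump (b ∧ c) j ≡ bump b (bump c k)
  step true  true  eq = trans (ℕ.+-suc _ _) (cong suc eq)
  step true  false eq = cong suc eq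
  step false c     eq = eq

-- A letter left by a descent is a peak or a double descent; the final edge to `⊤⁺` is never a
-- descent.
peaks+falls≡des : ∀ r x w → r ≢ [ x ] → Unique (x ∷ w) →
  peaks (window r x w) ℕ.+ falls (window r x w) ≡ des (x ∷ w)
peaks+falls≡des r x [] r≢x _
  rewrite peaks-∷ r [ x ] ⊤⁺ [] (λ ()) | falls-∷ r [ x ] ⊤⁺ [] r≢x (λ ()) with up r [ x ]
... | true  = refl
... | false = refl
peaks+falls≡des r x (y ∷ w) r≢x ((x≢y ∷ _) ∷ u)
  rewrite peaks-∷ r [ x ] [ y ] (window [ x ] y w) (x≢y ∘ []-injective)
        | falls-∷ r [ x ] [ y ] (window [ x ] y w) r≢x (x≢y ∘ []-injective)
        | des-∷ w (x≢y ∘ []-injective)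
        = step (up r [ x ]) (up [ x ] [ y ]) (peaks+falls≡des [ x ] y w (x≢y ∘ []-injective) u)
  where
  step : ∀ b c {i j k} → i ℕ.+ j ≡ k →
    bump (b ∧ not c) i ℕ.+ bump (not b ∧ not c) j ≡ bump (not c) k
  step true  true  eq = eq
  step true  false eq = cong suc eq
  step false true  eq = eq
  step false false eq = trans (ℕ.+-suc _ _) (cong suc eq)

-- Inner insertion as the derivation

module _ {c} {C : Set c} (a b : C) where

  -- The Booleans tell whether a letter is entered and left by an ascent; a valley carries no
  -- factor.
  shape : Bool → Bool → List (Factor C)
  shape true  true  = lin a ∷ []
  shape true  false = peak ∷ []
  shape false true  = []
  shape false false = lin b ∷ []

  -- The Boolean tells whether x is entered by an ascent.
  facs : Bool → ℕ → Word → List (Factor C)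
  facs e x []      = shape e true
  facs e x (y ∷ w) = shape e (does (x ℕ.<? y)) ++ facs (does (x ℕ.<? y)) y w

  -- The old last letter was already left by an ascent, to `+∞`, so it keeps its factor; `N` becomes
  -- a double ascent.
  facs-∷ʳ : ∀ e x w → x < N → All (_< N) w → facs e x (w ∷ʳ N) ≡ facs e x w ∷ʳ lin a
  facs-∷ʳ {N} e x []      x<N _ rewrite dec-true (x ℕ.<? N) x<N = refl
  facs-∷ʳ     e x (y ∷ w) _ (y<N ∷ w<N) = trans
    (cong (shape e _ ++_) (facs-∷ʳ (does (x ℕ.<? y)) y w y<N w<N))
    (sym (++-assoc (shape e _) (facs (does (x ℕ.<? y)) y w) _))

  module _ {N : ℕ} where

    -- Each edge is charged to its larger end: two edges to a peak, one to a double ascent or double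
    -- descent, none to a valley. Here the edge into `x` ascends and is charged to `x`, which gives
    -- the extra first term, an insertion just before `x`.
    ∂-facs⁺ : ∀ x w → x < N → All (_< N) w →
      ∂ a b (facs true x w) ≡ (peak ∷ facs false x w) ∷ map (facs true x) (insertInner N w)

    -- The edge into `x` descends and is charged to the letter before, so only insertions behind `x`
    -- appear.
    ∂-facs⁻ : ∀ x w → x < N → All (_< N) w →
      ∂ a b (facs false x w) ≡ map (facs false x) (insertInner N w)

    facs-insertInner-∷ : ∀ e x y w →
      map (shape e (does (x ℕ.<? y)) ++_) (map (facs (does (x ℕ.<? y)) y) (insertInner N w))
      ≡ map (facs e x) (map (y ∷_) (insertInner N w))
    facs-insertInner-∷ e x y w = trans (sym (map-∘ (insertInner N w))) (map-∘ (insertInner N w))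

    ∂-facs⁺ x []      _   _           = refl
    ∂-facs⁺ x (y ∷ w) x<N (y<N ∷ w<N)
      rewrite dec-true (x ℕ.<? N) x<N | dec-false (N ℕ.<? y) (ℕ.<-asym y<N)
            | sym (facs-insertInner-∷ true x y w)
      with does (x ℕ.<? y)
    ... | true  = cong (λ fss → (peak ∷ facs true y w) ∷ map (lin a ∷_) fss) (∂-facs⁺ y w y<N w<N)
    -- `x` is a peak: with `N` before it, it becomes a double descent; with `N` behind it, a double
    -- ascent.
    ... | false = cong (λ fss → (peak ∷ lin b ∷ facs false y w) ∷ (lin a ∷ peak ∷ facs false y w) ∷ map (peak ∷_) fss)
                       (∂-facs⁻ y w y<N w<N)

    ∂-facs⁻ x []      _   _           = refl
    ∂-facs⁻ x (y ∷ w) x<N (y<N ∷ w<N)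
      rewrite dec-true (x ℕ.<? N) x<N | dec-false (N ℕ.<? y) (ℕ.<-asym y<N)
            | sym (facs-insertInner-∷ false x y w)
      with does (x ℕ.<? y)
    -- `x` is a valley without factor; the extra term for `y` is the insertion between `x` and `y`.
    ... | true  = trans (∂-facs⁺ y w y<N w<N)
                        (cong ((peak ∷ facs false y w) ∷_) (sym (map-id _)))
    ... | false = cong (λ fss → (peak ∷ facs false y w) ∷ map (lin b ∷_) fss) (∂-facs⁻ y w y<N w<N)

-- Weighted enumeration of PRW words

module Enumeration {c ℓ} (R : CommutativeRing c ℓ) (a b w s α : CommutativeRing.Carrier R) where
  open CommutativeRing R hiding (zero) renaming (refl to ≈-refl; sym to ≈-sym; trans to ≈-trans)
  open Polynomials R
  open Sums R
  open Taylor R w s α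
  open ≈-Reasoning setoid
  open Exp commutativeSemiring using (^-congʳ)
  open NaturalCoefficients commutativeSemiring using (solve; _:=_; _:+_; _:*_)

  shape-weight : ∀ e e′ i j k {fs} → w ^ i * a ^ j * b ^ k ≈ ∏ fs →
    w ^ bump (e ∧ not e′) i * a ^ bump (e ∧ e′) j * b ^ bump (not e ∧ not e′) k ≈ ∏ (shape a b e e′ ++ fs)
  shape-weight true true i j k eq = ≈-trans
    (solve 4 (λ v x y z → x :* (v :* y) :* z := v :* (x :* y :* z)) ≈-refl a _ _ _) (*-congˡ eq)
  shape-weight true false i j k eq = ≈-trans
    (solve 4 (λ v x y z → v :* x :* y :* z := v :* (x :* y :* z)) ≈-refl w _ _ _) (*-congˡ eq)
  shape-weight false true i j k eq = eq
  shape-weight false false i j k eq = ≈-trans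
    (solve 4 (λ v x y z → x :* y :* (v :* z) := v :* (x :* y :* z)) ≈-refl b _ _ _) (*-congˡ eq)

  weight : List Triple → Carrier
  weight T = w ^ peaks T * a ^ rises T * b ^ falls T

  facs-weight : ∀ r x v → r ≢ [ x ] → Unique (x ∷ v) →
    weight (window r x v) ≈ ∏ (facs a b (up r [ x ]) x v)
  facs-weight r x [] r≢x _
    rewrite peaks-∷ r [ x ] ⊤⁺ [] (λ ()) | rises-∷ r [ x ] ⊤⁺ [] | falls-∷ r [ x ] ⊤⁺ [] r≢x (λ ()) =
    ≈-trans (shape-weight (up r [ x ]) true 0 0 0 {[]} (≈-trans (*-identityʳ _) (*-identityʳ _)))
          (reflexive (cong ∏ (++-identityʳ (shape a b (up r [ x ]) true))))
  facs-weight r x (y ∷ v) r≢x ((x≢y ∷ _) ∷ u)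
    rewrite peaks-∷ r [ x ] [ y ] (window [ x ] y v) (x≢y ∘ []-injective)
          | rises-∷ r [ x ] [ y ] (window [ x ] y v)
          | falls-∷ r [ x ] [ y ] (window [ x ] y v) r≢x (x≢y ∘ []-injective) =
    shape-weight (up r [ x ]) (up [ x ] [ y ]) _ _ _ (facs-weight [ x ] y v (x≢y ∘ []-injective) u)

  -- Each letter before 1 is entered and left by a descent, hence a double descent of weight `b`.
  facs-decreasing : ∀ d D W → AllPairs _>_ (d ∷ D ∷ʳ 1) →
    ∏ (facs a b false d (word (D , W))) ≈ b ^ suc (length D) * ∏ (facs a b false 1 W)
  facs-decreasing d [] W ((1<d ∷ _) ∷ _) rewrite dec-false (d ℕ.<? 1) (ℕ.<-asym 1<d) =
    *-congʳ (≈-sym (*-identityʳ b))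
  facs-decreasing d (e ∷ D) W ((e<d ∷ _) ∷ D>) rewrite dec-false (d ℕ.<? e) (ℕ.<-asym e<d) =
    ≈-trans (*-congˡ (facs-decreasing e D W D>)) (≈-sym (*-assoc _ _ _))

  word-weight : ∀ D W → AllPairs _>_ (D ∷ʳ 1) → Unique (word (D , W)) →
    weight (triples (pad (word (D , W)))) ≈ b ^ length D * ∏ (facs a b false 1 W)
  word-weight []      W _  u = ≈-trans (facs-weight ⊤⁺ 1 W (λ ()) u) (≈-sym (*-identityˡ _))
  word-weight (d ∷ D) W D> u =
    ≈-trans (facs-weight ⊤⁺ d (word (D , W)) (λ ()) u) (facs-decreasing d D W D>)

  α-exponent : Word → ℕ
  α-exponent σ = LRmin σ ℕ.+ RLmin σ ∸ 2

  -- The letter 1 is a minimum from both sides, and the subtracted 2 removes exactly these two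
  -- counts.
  α-exponent-word : ∀ {D W} → Valid n (D , W) → α-exponent (word (D , W)) ≡ length D ℕ.+ RLmin W
  α-exponent-word {D = D} {W} P
    rewrite LRmin-word D W (decreasing P) (1< P)
          | RLmin-word D W (>last D (decreasing P)) (1< P)
          | ℕ.+-suc (length D) (RLmin W) = refl

  -- The sum of the weights of all words obtained from D 1 W by k insertions.
  descendants : ℕ → Word × Word → Carrier
  descendants k (D , W) = α ^ (length D ℕ.+ RLmin W) * b ^ length D * T a b k (facs a b false 1 W)

  descendants-0 : ∀ {p} → Valid n p → let σ = word p in
    w ^ M σ * a ^ da σ * b ^ dd σ * α ^ α-exponent σ ≈ descendants 0 p
  descendants-0 {p = D , W} P = ≈-trans
    (*-cong (word-weight D W (decreasing P) (distinct P)) (^-congʳ α (α-exponent-word P)))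
    (solve 3 (λ x y z → x :* y :* z := z :* x :* y) ≈-refl _ _ _)

  -- A front insertion contributes `α * b`, an end insertion `α` and a factor `lin a`, and the inner
  -- ones the derivative, which together is one step of `T`.
  descendants-suc : s ≈ b + a → ∀ k p → Valid n p →
    ∑ (grow (2 ℕ.+ n) p) (descendants k) ≈ descendants (suc k) p
  descendants-suc {n} s≈ k (D , W) P = begin
    descendants k (top ∷ D , W) + (descendants k (D , W ∷ʳ top) + ∑ (map (D ,_) inner) (descendants k))
      ≈⟨ +-congˡ (+-cong end interior) ⟩
    α * α ^ e * (b * b ^ length D) * T a b k fs
      + (α * α ^ e * b ^ length D * T a b k (fs ∷ʳ lin a) + α ^ e * b ^ length D * ∑ (∂ a b fs) (T a b k))
      ≈⟨ solve 7 (λ α b αᵉ bᵈ t t′ t″ →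
           α :* αᵉ :* (b :* bᵈ) :* t :+ (α :* αᵉ :* bᵈ :* t′ :+ αᵉ :* bᵈ :* t″)
             := αᵉ :* bᵈ :* (t″ :+ α :* (b :* t :+ t′)))
           ≈-refl α b (α ^ e) (b ^ length D) _ _ _ ⟩
    α ^ e * b ^ length D * (∑ (∂ a b fs) (T a b k) + α * (b * T a b k fs + T a b k (fs ∷ʳ lin a)))
      -- As `s ≈ b + a`, the appended `lin s` splits into the front scalar `b` and the end factor
      -- `lin a`.
      ≈⟨ *-congˡ (+-congˡ (*-congˡ affine)) ⟨
    descendants (suc k) (D , W) ∎
    where
    top e : ℕ
    top = 2 ℕ.+ n
    e = length D ℕ.+ RLmin W

    fs : Factors
    fs = facs a b false 1 W

    inner : List Word
    inner = insertInner top W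

    W<top : All (_< top) W
    W<top = All.tail (All.++⁻ʳ D (<top P))

    end : descendants k (D , W ∷ʳ top) ≈ α * α ^ e * b ^ length D * T a b k (fs ∷ʳ lin a)
    end rewrite RLmin-∷ʳ W W<top | ℕ.+-suc (length D) (RLmin W)
              | facs-∷ʳ a b false 1 W (s<s (z<s {n})) W<top = ≈-refl

    interior : ∑ (map (D ,_) inner) (descendants k) ≈ α ^ e * b ^ length D * ∑ (∂ a b fs) (T a b k)
    interior = begin
      ∑ (map (D ,_) inner) (descendants k)
        ≡⟨ ∑-map (D ,_) inner (descendants k) ⟩
      ∑[ v ∈ inner ] descendants k (D , v)
        ≈⟨ ∑-cong inner (λ {v} v∈ → *-congʳ (*-congʳ (^-congʳ α
             (cong (length D ℕ.+_) (RLmin-insertInner W W<top v∈))))) ⟩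
      ∑[ v ∈ inner ] (α ^ e * b ^ length D * T a b k (facs a b false 1 v))
        ≈⟨ ∑-distribˡ _ inner (T a b k ∘ facs a b false 1) ⟨
      α ^ e * b ^ length D * ∑ inner (T a b k ∘ facs a b false 1)
        ≡⟨ cong (α ^ e * b ^ length D *_) (∑-map (facs a b false 1) inner (T a b k)) ⟨
      α ^ e * b ^ length D * ∑ (map (facs a b false 1) inner) (T a b k)
        ≡⟨ cong (λ fss → α ^ e * b ^ length D * ∑ fss (T a b k)) (∂-facs⁻ a b 1 W (s<s z<s) W<top) ⟨
      α ^ e * b ^ length D * ∑ (∂ a b fs) (T a b k) ∎

    affine : T a b k (fs ∷ʳ lin s) ≈ b * T a b k fs + T a b k (fs ∷ʳ lin a)
    affine = ≈-trans (T-affine a b k b a s≈ fs [])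
      (+-congʳ (*-congˡ (reflexive (cong (T a b k) (++-identityʳ fs)))))

  -- Induction trades one generation for one more pending insertion, down to the word 1, which has
  -- no factors.
  ∑-generated : s ≈ b + a → ∀ n k → ∑ (generated n) (descendants k) ≈ T a b (n ℕ.+ k) []
  ∑-generated s≈ zero    k = ≈-trans (+-identityʳ _) (≈-trans (*-congʳ (*-identityˡ _)) (*-identityˡ _))
  ∑-generated s≈ (suc n) k = begin
    ∑ (concatMap (grow (2 ℕ.+ n)) (generated n)) (descendants k)
      ≈⟨ ∑-concatMap (grow (2 ℕ.+ n)) (generated n) (descendants k) ⟩
    ∑[ p ∈ generated n ] ∑ (grow (2 ℕ.+ n) p) (descendants k)
      ≈⟨ ∑-cong (generated n) (λ {p} p∈ → descendants-suc s≈ k p (All.lookup (generated-valid n) p∈)) ⟩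
    ∑ (generated n) (descendants (suc k))
      ≈⟨ ∑-generated s≈ n (suc k) ⟩
    T a b (n ℕ.+ suc k) []
      ≡⟨ cong (λ m → T a b m []) (ℕ.+-suc n k) ⟩
    T a b (suc n ℕ.+ k) [] ∎

  ∑-PRW : s ≈ b + a → ∀ n (f : Word → Carrier) →
    (∀ {p} → Valid n p → let σ = word p in
      f σ ≈ w ^ M σ * a ^ da σ * b ^ dd σ * α ^ α-exponent σ) →
    ∑ (PRW (suc n)) f ≈ T a b (n ℕ.+ 0) []
  ∑-PRW s≈ n f f≈ = begin
    ∑ (PRW (suc n)) f              ≈⟨ ∑-↭ f (PRW-↭ n) ⟩
    ∑ (map word (generated n)) f   ≡⟨ ∑-map word (generated n) f ⟩
    ∑ (generated n) (f ∘ word)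
      ≈⟨ ∑-cong (generated n) (λ p∈ → let P = All.lookup (generated-valid n) p∈ in
           ≈-trans (f≈ P) (descendants-0 P)) ⟩
    ∑ (generated n) (descendants 0) ≈⟨ ∑-generated s≈ n 0 ⟩
    T a b (n ℕ.+ 0) []             ∎

-- Comparison of the two sides

M+da≡asc : ∀ σ → Unique σ → M σ ℕ.+ da σ ≡ asc σ
M+da≡asc []      _ = refl
M+da≡asc (x ∷ σ) u = peaks+rises≡asc ⊤⁺ x σ u

M+dd≡des : ∀ σ → Unique σ → M σ ℕ.+ dd σ ≡ des σ
M+dd≡des []      _ = refl
M+dd≡des (x ∷ σ) u = peaks+falls≡des ⊤⁺ x σ (λ ()) u

theorem1p5 : ∀ {c ℓ} (R : CommutativeRing c ℓ) →
    let open CommutativeRing R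
        open Polynomials R in
    (n : ℕ) → n ≥ 1 →
    (x y α u₁ u₂ u₃ u₄ : Carrier) →
    x + y ≈ u₃ + u₄ →
    x * y ≈ u₁ * u₂ →
    Ã n x y α ≈
      ∑[ σ ∈ PRW (suc n) ]
        ((u₁ * u₂) ^ M σ * u₃ ^ da σ * u₄ ^ dd σ * α ^ (LRmin σ ℕ.+ RLmin σ ∸ 2))
theorem1p5 R n _ x y α u₁ u₂ u₃ u₄ x+y≈u₃+u₄ xy≈u₁u₂ = begin
  Ã n x y α
    ≈⟨ Enumeration.∑-PRW R y x (x * y) (x + y) α ≈-refl n _
         (λ P → *-congʳ (des-asc-weight _ (distinct P))) ⟩
  T y x (n ℕ.+ 0) []
    ≈⟨ T-invariant (≈-trans (+-comm y x) x+y≈u₃+u₄) (n ℕ.+ 0) [] ⟩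
  T u₃ u₄ (n ℕ.+ 0) []
    -- Both enumerations use `w = x * y` and `s = x + y`, so that they share one `T`.
    ≈⟨ Enumeration.∑-PRW R u₃ u₄ (x * y) (x + y) α (≈-trans x+y≈u₃+u₄ (+-comm u₃ u₄)) n _
         (λ {p} _ → *-congʳ (*-congʳ (*-congʳ (^-congˡ (M (word p)) (≈-sym xy≈u₁u₂))))) ⟨
  ∑[ σ ∈ PRW (suc n) ]
    ((u₁ * u₂) ^ M σ * u₃ ^ da σ * u₄ ^ dd σ * α ^ (LRmin σ ℕ.+ RLmin σ ∸ 2)) ∎
  where
  open CommutativeRing R hiding (zero) renaming (refl to ≈-refl; sym to ≈-sym; trans to ≈-trans)
  open Polynomials R
  open Taylor R (x * y) (x + y) α
  open ≈-Reasoning setoid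
  open Exp commutativeSemiring using (^-homo-*; ^-congˡ; ^-distrib-*)
  open NaturalCoefficients commutativeSemiring using (solve; _:=_; _:*_)

  des-asc-weight : ∀ σ → Unique σ → x ^ des σ * y ^ asc σ ≈ (x * y) ^ M σ * y ^ da σ * x ^ dd σ
  des-asc-weight σ u = begin
    x ^ des σ * y ^ asc σ
      ≡⟨ cong₂ (λ i j → x ^ i * y ^ j) (M+dd≡des σ u) (M+da≡asc σ u) ⟨
    x ^ (M σ ℕ.+ dd σ) * y ^ (M σ ℕ.+ da σ)
      ≈⟨ *-cong (^-homo-* x (M σ) (dd σ)) (^-homo-* y (M σ) (da σ)) ⟩
    (x ^ M σ * x ^ dd σ) * (y ^ M σ * y ^ da σ)
      ≈⟨ solve 4 (λ i j k l → (i :* j) :* (k :* l) := (i :* k) :* l :* j) ≈-refl _ _ _ _ ⟩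
    (x ^ M σ * y ^ M σ) * y ^ da σ * x ^ dd σ
      ≈⟨ *-congʳ (*-congʳ (^-distrib-* x y (M σ))) ⟨
    (x * y) ^ M σ * y ^ da σ * x ^ dd σ ∎
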